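{- Let $S=(M_{\mathsf A})_{\mathsf A\in\mathcal P}$ be a system of (deterministic) reversible CFSMs. If $\langle\sigma,\chi,\beta\rangle\in \mathsf{RC}_S$, i.e. $\langle\sigma,\chi,\beta\rangle$ is a forward reachable configuration of $S$, then $\mathsf{forget}(\langle\sigma,\chi,\beta\rangle)\in \mathsf{RC}_{\mathsf{forget}(S)}$, i.e. $\mathsf{forget}(\langle\sigma,\chi,\beta\rangle)$ is a reachable configuration of the standard CFSM system $\mathsf{forget}(S)$.
   Context: **Basic sets.** $\mathcal P$ is a finite set of participants, $\mathcal M$ a set of messages containing two distinguished messages $\dagger,\ddagger$ (start / end of loop), $\mathbb Z_0$ the nonzero integers (control points). These three sets are pairwise disjoint. Channels: $\mathcal C=\{(\mathsf A,\mathsf B)\in\mathcal P\times\mathcal P\mid \mathsf A\ne\mathsf B\}$, and $(\mathsf A,\mathsf B)$ is written $\mathsf A\cdot\mathsf B$. Events: $\mathcal E=\mathcal E^!\cup\mathcal E^?$ with $\mathcal E^!=\mathcal C\times\{!\}\times\mathbb Z_0\times\mathcal M$ (outputs, written $\mathsf A\cdot\mathsf B!^i m$) and $\mathcal E^?=\mathcal C\times\{?\}\times\mathbb Z_0\times\mathcal M$ (inputs, written $\mathsf A\cdot\mathsf B?^i m$). The subject is $\mathsf{sbj}(\mathsf A\cdot\mathsf B!^i m)=\mathsf A$ and $\mathsf{sbj}(\mathsf A\cdot\mathsf B?^i m)=\mathsf B$. $\Phi$ is the set of guards generated by $\phi::=p(\mathsf A_1\cdot\mathsf B_1,\dots,\mathsf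 A_N\cdot\mathsf B_N)\mid m\in\mathsf A\cdot\mathsf B\mid\neg\phi\mid\phi\vee\phi$, with $p$ from an unspecified set of predicate symbols. **Reversible CFSMs.** For a set $Q$ put $L_Q=Q\times\mathcal E\times\Phi$ and let $\overline{L_Q}=\{\overline l\mid l\in L_Q\}$ be a disjoint marked copy. Let $\mathbf 1$ be a distinguished symbol. For $\lambda=(q,e,\phi)$ or $\lambda=\overline{(q,e,\phi)}$ write $\lambda_Q=q$, $\lambda_{\mathcal E}=e$, $\lambda_\Phi=\phi$. A reversible CFSM (r-CFSM) for $\mathsf A\in\mathcal P$ is a finite transition system $M=(Q,q_0,\to)$ with $q_0\in Q$ and $\to\,\subseteq Q\times\mathcal E\times(\{\mathbf 1\}\cup L_Q\cup\overline{L_Q})\times Q$ such that for every $(q,e,\lambda,q')\in\,\to$: $\mathsf{sbj}(e)=\mathsf A$ and, if $\lambda\neq\mathbf 1$, the guard $\lambda_\Phi$ predicates only on channels of $\mathsf A$. Write $q\xrightarrow[\lambda]{e}q'$ for $(q,e,\lambda,q')\in\,\to$. A system $S=(M_{\mathsf A})_{\mathsf A\in\mathcal P}$ assigns to each $\mathsf A\in\mathcal P$ an r-CFSM $M_{\mathsf A}=(Q_{\mathsf A},q_{0\mathsf A},\to_{\mathsf A})$ for $\mathsf A$. Only deterministic machines are considered, the sets $Q_{\mathsf A}$ are pairwise disjoint, and $\mathcal Q_S=\bigcup_{\mathsf A}Q_{\mathsf A}$. **Configurations.** $\mathsf{Log}=\mathcal M\times\mathcal Q_S\times\mathbb Z_0\times\mathbb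 N$. A log $(m,q,i,t)$ records a message $m$, the sender's state $q$ when sending, the control point $i$, and a time-stamp $t$. A channel content is a pair in $\mathsf{Log}^\star\times\mathsf{Log}^\star$, written $\ell_1,\dots,\ell_{p-1}\,;\,\ell_p,\dots,\ell_h$, with strictly increasing time-stamps along $\ell_1,\dots,\ell_h$. The left part is the already consumed logs (history), the right part the pending ones. A configuration is $\langle\sigma,\chi,\beta\rangle$ with $\sigma:\mathcal P\to\mathcal Q_S$, $\sigma(\mathsf A)\in Q_{\mathsf A}$; $\chi:\mathcal C\to\mathsf{Log}^\star\times\mathsf{Log}^\star$; $\beta:\mathcal Q_S\to 2^{\mathcal E\times\Phi}\times\{\mathtt{tt},\mathtt{ff}\}$. The initial configuration $\langle\sigma_0,\chi_0,\beta_0\rangle$ has $\sigma_0(\mathsf A)=q_{0\mathsf A}$, $\chi_0(\mathsf A\cdot\mathsf B)=(\varepsilon\,;\,\varepsilon)$, $\beta_0(q)=(\emptyset,\mathtt{ff})$. **Forward semantics.** When $\beta(q)=(X,b)$, "$z\in\beta(q)$" means $z\in X$. A decoration $\lambda$ is valid for $\beta$ if $\lambda=\mathbf 1$, or $(\lambda_{\mathcal E},\lambda_\Phi)\in\beta(\lambda_Q)$ implies that the boolean component of $\beta(\lambda_Q)$ is $\mathtt{tt}$. The partial map $\mathrm{upd}_O(\lambda,\beta)$ equals $\beta$ if $\lambda=\mathbf 1$ or ($\lambda\in L_Q$ and $\lambda$ is valid for $\beta$); equals $\beta[\lambda_Q\mapsto(\emptyset,\mathtt{ff})]$ if $\lambda\in\overline{L_Q}$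 and $\lambda$ is valid for $\beta$; and is undefined otherwise. The total map $\mathrm{upd}_I(\lambda,\beta)$ equals $\beta$ if $\lambda\notin\overline{L_Q}$ and $\beta[\lambda_Q\mapsto(\emptyset,\mathtt{ff})]$ if $\lambda\in\overline{L_Q}$. The relation $\Longrightarrow$ is the smallest one closed under: - [out] if $\sigma(\mathsf A)\xrightarrow[\lambda]{\mathsf A\cdot\mathsf B!^i m}q$ in $M_{\mathsf A}$ and $\mathrm{upd}_O(\lambda,\beta)$ is defined, then $\langle\sigma,\chi,\beta\rangle\Longrightarrow\langle\sigma[\mathsf A\mapsto q],\chi[\mathsf A\cdot\mathsf B\mapsto\chi(\mathsf A\cdot\mathsf B).\ell],\mathrm{upd}_O(\lambda,\beta)\rangle$, where $\ell=(m,\sigma(\mathsf A),i,t)$ is appended at the end of the pending part and $t=1+\max\{t'\mid(\_,\_,\_,t')\in\chi(\mathsf A\cdot\mathsf C),\ \mathsf C\in\mathcal P\setminus\{\mathsf A\}\}$ ($\max\emptyset=0$; logs in both parts of the channels count). - [inp] if $\sigma(\mathsf A)\xrightarrow[\lambda]{\mathsf B\cdot\mathsf A?^i m}q$ in $M_{\mathsf A}$, $\chi(\mathsf B\cdot\mathsf A)=\ell_1,\dots,\ell_{p-1}\,;\,\ell_p,\dots,\ell_h$ and the message component of $\ell_p$ is $m$, then $\langle\sigma,\chi,\beta\rangle\Longrightarrow\langle\sigma[\mathsf A\mapsto q],\chi[\mathsf B\cdot\mathsf A\mapsto\ell_1,\dots,\ell_p\,;\,\ell_{p+1},\dots,\ell_h],\mathrm{upd}_I(\lambda,\beta)\rangle$.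 $\mathsf{RC}_S$ is the set of configurations reachable from the initial one by the reflexive-transitive closure of $\Longrightarrow$. **Standard CFSMs and forget.** A standard CFSM is $(Q,q_0,\to)$ with $\to\,\subseteq Q\times\mathcal E\times Q$. Configurations of a standard system are pairs $\langle\sigma,\chi\rangle$ with $\sigma$ a map assigning to each participant $\mathsf A\in\mathcal P$ a state $\sigma(\mathsf A)$ of the machine of $\mathsf A$ in that system, and $\chi:\mathcal C\to\mathcal M^\star$; initially all machines are in their initial state and all channels are empty. A transition $\sigma(\mathsf A)\xrightarrow{\mathsf A\cdot\mathsf B!^i m}q$ moves $\mathsf A$ to $q$ and appends $m$ to $\chi(\mathsf A\cdot\mathsf B)$. A transition $\sigma(\mathsf A)\xrightarrow{\mathsf B\cdot\mathsf A?^i m}q$ is enabled when $m$ is the first element of $\chi(\mathsf B\cdot\mathsf A)$, moves $\mathsf A$ to $q$ and removes that $m$. $\mathsf{RC}_{S'}$ is the set of configurations of the standard system $S'$ reachable from its initial one. For an r-CFSM $M=(Q,q_0,\to)$, $\mathsf{forget}(M)=(Q,q_0,\{(q,e,q')\mid(q,e,\lambda,q')\in\,\to\})$, and $\mathsf{forget}(S):\mathsf A\mapsto\mathsf{forget}(S(\mathsf A))$. On logs $\mathsf{forget}(m,q,i,t)=m$, extended pointwise to sequences. On configurations $\mathsf{forget}(\langle\sigma,\chi,\beta\rangle)=\langle\sigma,\chi'\rangle$ with $\chi'(\mathsf A\cdot\mathsf B)=\mathsf{forget}(\ell_1),\dots,\mathsf{forget}(\ell_n)$ when $\chi(\mathsf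 A\cdot\mathsf B)=(\_\,;\,\ell_1,\dots,\ell_n)$, so only pending messages are kept. -}

module Defs where

open import Data.Bool.Base using (Bool; true; false)
open import Data.Empty using (⊥-elim-irr)
open import Data.Fin.Base using (Fin)
import Data.Fin.Properties as Fin
open import Data.Integer.Base using (ℤ; NonZero)
open import Data.List.Base using (List; []; _∷_; _++_; [_]; map; concatMap; allFin)
open import Data.List.Extrema.Nat using (max; xs≤max)
open import Data.List.Membership.Propositional using (_∈_)
open import Data.List.Membership.Propositional.Properties using (∈-concatMap⁺; ∈-allFin)
open import Data.List.Properties using (++-assoc)
open import Data.List.Relation.Unary.All as All using (All; []; _∷_)
import Data.List.Relation.Unary.All.Properties as All
open import Data.List.Relation.Unary.AllPairs using (AllPairs; []; _∷_)
import Data.List.Relation.Unary.AllPairs.Properties as AllPairs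
import Data.List.Relation.Unary.Any as Any
open import Data.Nat.Base using (ℕ; suc; _<_; s≤s)
open import Data.Product.Base using (Σ-syntax; _×_; _,_; proj₁; proj₂; ∃-syntax)
open import Data.Product.Properties using (≡-dec)
open import Data.Refinement using (Refinement-syntax)
open import Data.Unit.Base using (⊤)
open import Function.Base using (_on_)
open import Level using (Level; 0ℓ) renaming (suc to lsuc)
open import Relation.Binary.Construct.Closure.ReflexiveTransitive using (Star)
open import Relation.Binary.Core using (Rel)
open import Relation.Binary.Definitions using (DecidableEquality)
open import Relation.Binary.PropositionalEquality.Core using (_≡_; _≢_; refl; sym; subst)
open import Relation.Nullary.Decidable.Core using (yes; no)
open import Relation.Unary using (Pred; ∅; _≐_)
import Relation.Unary as Unary

module _ {a b : Level} {A : Set a} {B : A → Set b} (_≟_ : DecidableEquality A) where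

  update : (∀ x → B x) → (a : A) → B a → ∀ x → B x
  update f a b x with a ≟ x
  ... | yes refl = b
  ... | no  _    = f x

record Signature : Set₁ where
  field
    #participants : ℕ
    Message       : Set
    † ‡           : Message
    †≢‡           : † ≢ ‡
    PredSymbol    : Set

module Systems (Sig : Signature) where
  open Signature Sig

  Participant : Set
  Participant = Fin #participants

  ControlPoint : Set
  ControlPoint = [ i ∈ ℤ ∣ NonZero i ]

  -- The side condition is irrelevant, so a channel is determined by its
  -- two end points.
  record Channel : Set where
    constructor _·_⟨_⟩
    field
      sender    : Participant
      receiver  : Participant
      .distinct : sender ≢ receiver

  open Channel public using (sender; receiver)

  _≟ᶜ_ : DecidableEquality Channel
  (A · B ⟨ _ ⟩) ≟ᶜ (A′ · B′ ⟨ _ ⟩) with A Fin.≟ A′ | B Fin.≟ B′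
  ... | yes refl | yes refl = yes refl
  ... | no A≢A′  | _        = no λ { refl → A≢A′ refl }
  ... | yes _    | no B≢B′  = no λ { refl → B≢B′ refl }

  data Event : Set where
    _!⟨_⟩_ : Channel → ControlPoint → Message → Event
    _?⟨_⟩_ : Channel → ControlPoint → Message → Event

  subject : Event → Participant
  subject (c !⟨ i ⟩ m) = sender c
  subject (c ?⟨ i ⟩ m) = receiver c

  data Guard : Set where
    predᵍ : PredSymbol → List Channel → Guard
    _∈ᵍ_  : Message → Channel → Guard
    ¬ᵍ_   : Guard → Guard
    _∨ᵍ_  : Guard → Guard → Guard

  channelsOf : Guard → List Channel
  channelsOf (predᵍ p cs) = cs
  channelsOf (m ∈ᵍ c)     = [ c ]
  channelsOf (¬ᵍ φ)       = channelsOf φ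
  channelsOf (φ ∨ᵍ ψ)     = channelsOf φ ++ channelsOf ψ

  data _EndOf_ (A : Participant) (c : Channel) : Set where
    isSender   : sender c ≡ A → A EndOf c
    isReceiver : receiver c ≡ A → A EndOf c

  data Decoration (Q : Set) : Set where
    𝟏      : Decoration Q
    plain  : Q × Event × Guard → Decoration Q
    marked : Q × Event × Guard → Decoration Q

  GuardOn : ∀ {Q} → Participant → Decoration Q → Set
  GuardOn A 𝟏                  = ⊤
  GuardOn A (plain  (_ , _ , φ)) = All (A EndOf_) (channelsOf φ)
  GuardOn A (marked (_ , _ , φ)) = All (A EndOf_) (channelsOf φ)

  record RCFSM (A : Participant) : Set where
    field
      #states     : ℕ
    State : Set
    State = Fin #states
    field
      initial     : State
      transitions : List (State × Event × Decoration State × State)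
      subject-ok  : ∀ {q e d q′} → (q , e , d , q′) ∈ transitions → subject e ≡ A
      guard-ok    : ∀ {q e d q′} → (q , e , d , q′) ∈ transitions → GuardOn A d

  record CFSM : Set where
    field
      #states     : ℕ
    State : Set
    State = Fin #states
    field
      initial     : State
      transitions : List (State × Event × State)

  open RCFSM public

  -- Determinism over the alphabet of events, i.e. of the underlying CFSM.
  Deterministic : ∀ {A} → RCFSM A → Set
  Deterministic M = ∀ {q e d₁ d₂ q₁ q₂} →
    (q , e , d₁ , q₁) ∈ transitions M → (q , e , d₂ , q₂) ∈ transitions M → q₁ ≡ q₂

  System : Set
  System = (A : Participant) → RCFSM A

  module Reversible (S : System) where

    -- The tag makes the state sets of different participants disjoint.
    GlobalState : Set
    GlobalState = Σ[ A ∈ Participant ] State (S A)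

    _≟ˢ_ : DecidableEquality GlobalState
    _≟ˢ_ = ≡-dec Fin._≟_ Fin._≟_

    record Log : Set where
      constructor log
      field
        message : Message
        origin  : GlobalState
        point   : ControlPoint
        time    : ℕ

    open Log public

    Increasing : List Log → Set
    Increasing = AllPairs (_<_ on time)

    record Content : Set where
      constructor content
      field
        history     : List Log
        pending     : List Log
        .increasing : Increasing (history ++ pending)

    open Content public using (history; pending)

    logs : Content → List Log
    logs x = history x ++ pending x

    increasing-∷ʳ : ∀ xs ys {ℓ} → Increasing (xs ++ ys) →
                    All (λ ℓ′ → time ℓ′ < time ℓ) (xs ++ ys) →
                    Increasing (xs ++ (ys ++ [ ℓ ]))
    increasing-∷ʳ xs ys {ℓ} inc below =
      subst Increasing (++-assoc xs ys [ ℓ ])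
        (AllPairs.++⁺ inc ([] ∷ []) (All.map (_∷ []) below))

    append : (x : Content) (ℓ : Log) →
             .(All (λ ℓ′ → time ℓ′ < time ℓ) (logs x)) → Content
    append (content h p inc) ℓ below =
      content h (p ++ [ ℓ ]) (increasing-∷ʳ h p inc below)

    consume : ∀ (x : Content) {ℓ ℓs} → .(pending x ≡ ℓ ∷ ℓs) → Content
    consume (content h p inc) {ℓ} {ℓs} eq =
      content (h ++ [ ℓ ]) ℓs
        (subst Increasing (sym (++-assoc h [ ℓ ] ℓs))
          (subst (λ p′ → Increasing (h ++ p′)) eq inc))

    Channels : Set
    Channels = Channel → Content

    timesTo : Channels → (A B : Participant) → List ℕ
    timesTo χ A B with A Fin.≟ B
    ... | yes _  = []
    ... | no A≢B = map time (logs (χ (A · B ⟨ A≢B ⟩)))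

    nextTime : Channels → Participant → ℕ
    nextTime χ A = suc (max 0 (concatMap (timesTo χ A) (allFin #participants)))

    timesTo-All : ∀ {P : Pred ℕ 0ℓ} χ c → All P (timesTo χ (sender c) (receiver c)) →
                  All (λ ℓ → P (time ℓ)) (logs (χ c))
    timesTo-All χ (A · B ⟨ A≢B ⟩) ps with A Fin.≟ B
    ... | yes A≡B = ⊥-elim-irr (A≢B A≡B)
    ... | no _    = All.map⁻ ps

    nextTime-fresh : ∀ χ c → All (λ ℓ → time ℓ < nextTime χ (sender c)) (logs (χ c))
    nextTime-fresh χ c = timesTo-All χ c (All.tabulate λ t∈ →
      s≤s (All.lookup (xs≤max 0 _)
        (∈-concatMap⁺ (timesTo χ (sender c)) (Any.map (λ { refl → t∈ }) (∈-allFin (receiver c))))))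

    Marking : Set₁
    Marking = GlobalState → Pred (Event × Guard) 0ℓ × Bool

    record Config : Set₁ where
      constructor ⟨_,_,_⟩
      field
        state   : (A : Participant) → State (S A)
        buffers : Channels
        marking : Marking

    initialConfig : Config
    initialConfig = ⟨ (λ A → initial (S A))
                    , (λ _ → content [] [] [])
                    , (λ _ → ∅ , false) ⟩

    module _ {A : Participant} where

      Valid : Decoration (State (S A)) → Marking → Set
      Valid 𝟏                    β = ⊤
      Valid (plain  (q , e , φ)) β = (e , φ) Unary.∈ proj₁ (β (A , q)) → proj₂ (β (A , q)) ≡ true
      Valid (marked (q , e , φ)) β = (e , φ) Unary.∈ proj₁ (β (A , q)) → proj₂ (β (A , q)) ≡ true

      -- A partial map, whose domain of definition is Valid.
      updO : (d : Decoration (State (S A))) (β : Marking) → .(Valid d β) → Marking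
      updO 𝟏                    β _ = β
      updO (plain  _)           β _ = β
      updO (marked (q , _ , _)) β _ = update _≟ˢ_ β (A , q) (∅ , false)

      updI : Decoration (State (S A)) → Marking → Marking
      updI 𝟏                    β = β
      updI (plain  _)           β = β
      updI (marked (q , _ , _)) β = update _≟ˢ_ β (A , q) (∅ , false)

    data _⟹_ : Rel Config (lsuc 0ℓ) where

      out : ∀ {σ χ β} c {i m d q} →
            let A = sender c in
            (σ A , c !⟨ i ⟩ m , d , q) ∈ transitions (S A) →
            (valid : Valid d β) →
            ⟨ σ , χ , β ⟩ ⟹
            ⟨ update Fin._≟_ σ A q
            , update _≟ᶜ_ χ c
                (append (χ c) (log m (A , σ A) i (nextTime χ A)) (nextTime-fresh χ c))
            , updO d β valid ⟩

      inp : ∀ {σ χ β} c {i m d q ℓ ℓs} →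
            let A = receiver c in
            (σ A , c ?⟨ i ⟩ m , d , q) ∈ transitions (S A) →
            (eq : pending (χ c) ≡ ℓ ∷ ℓs) →
            message ℓ ≡ m →
            ⟨ σ , χ , β ⟩ ⟹
            ⟨ update Fin._≟_ σ A q
            , update _≟ᶜ_ χ c (consume (χ c) eq)
            , updI d β ⟩

    -- Equality of configurations as maps.
    record _≈_ (k k′ : Config) : Set where
      open Config
      field
        state-≈   : ∀ A → state k A ≡ state k′ A
        buffers-≈ : ∀ c → buffers k c ≡ buffers k′ c
        marking-≈ : ∀ q → proj₁ (marking k q) ≐ proj₁ (marking k′ q)
                        × proj₂ (marking k q) ≡ proj₂ (marking k′ q)

    -- Functions are not extensional here, so a reachable configuration is
    -- one that is equal as a map to the end of a run.
    RC : Pred Config (lsuc 0ℓ)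
    RC k = ∃[ k′ ] (Star _⟹_ initialConfig k′ × k′ ≈ k)

  StandardSystem : Set
  StandardSystem = Participant → CFSM

  module Standard (S : StandardSystem) where

    record Config : Set where
      constructor ⟨_,_⟩
      field
        state   : (A : Participant) → CFSM.State (S A)
        buffers : Channel → List Message

    initialConfig : Config
    initialConfig = ⟨ (λ A → CFSM.initial (S A)) , (λ _ → []) ⟩

    data _⟶_ : Rel Config 0ℓ where

      out : ∀ {σ χ} c {i m q} →
            let A = sender c in
            (σ A , c !⟨ i ⟩ m , q) ∈ CFSM.transitions (S A) →
            ⟨ σ , χ ⟩ ⟶
            ⟨ update Fin._≟_ σ A q , update _≟ᶜ_ χ c (χ c ++ [ m ]) ⟩

      inp : ∀ {σ χ} c {i m q ms} →
            let A = receiver c in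
            (σ A , c ?⟨ i ⟩ m , q) ∈ CFSM.transitions (S A) →
            χ c ≡ m ∷ ms →
            ⟨ σ , χ ⟩ ⟶
            ⟨ update Fin._≟_ σ A q , update _≟ᶜ_ χ c ms ⟩

    record _≈_ (k k′ : Config) : Set where
      open Config
      field
        state-≈   : ∀ A → state k A ≡ state k′ A
        buffers-≈ : ∀ c → buffers k c ≡ buffers k′ c

    RC : Pred Config 0ℓ
    RC k = ∃[ k′ ] (Star _⟶_ initialConfig k′ × k′ ≈ k)

  forgetMachine : ∀ {A} → RCFSM A → CFSM
  forgetMachine M = record
    { #states     = #states M
    ; initial     = initial M
    ; transitions = map (λ (q , e , _ , q′) → q , e , q′) (transitions M)
    }

  forgetSystem : System → StandardSystem
  forgetSystem S A = forgetMachine (S A)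

  module _ (S : System) where
    private
      module R = Reversible S
      module F = Standard (forgetSystem S)

    forget : R.Config → F.Config
    forget R.⟨ σ , χ , β ⟩ = F.⟨ σ , (λ c → map R.message (R.pending (χ c))) ⟩

module Submission where

open import Defs
import Data.Fin.Properties as Fin
open import Data.List.Base using (map; _++_; [_])
open import Data.List.Membership.Propositional using () renaming (_∈_ to _∈ₗ_)
open import Data.List.Membership.Propositional.Properties using (∈-map⁺)
open import Data.List.Properties using (map-++)
open import Data.Product.Base using (_×_; _,_; ∃-syntax)
open import Function.Base using (id)
open import Level using (Level)
open import Relation.Binary.Construct.Closure.ReflexiveTransitive using (Star; ε; _◅_)
open import Relation.Binary.Definitions using (DecidableEquality)
open import Relation.Binary.PropositionalEquality
  using (_≡_; refl; sym; trans; cong)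
open import Relation.Nullary.Decidable.Core using (yes; no)
open import Relation.Unary using (_∈_)

-- Forgetting maps each transition of S to one of forget(S).  Function spaces are
-- not extensional, so the simulation relates configurations up to _≈_.

-- `forget` is a simulation: decorations only restrict when a forward step may fire, so dropping
-- them leaves a standard step with the same event. An output adds one log at the end of the pending
-- part, hence one message at the end of the queue. An input moves the first pending log into the
-- history, which `forget` discards, so the queue loses its head. Induction on the run then gives
-- the theorem.

module _ {a b c : Level} {A : Set a} {B : A → Set b} {C : A → Set c}
         (_≟_ : DecidableEquality A) (h : ∀ {x} → B x → C x) where

  -- Serves both components of `_≈_`: `h` is the identity for local states and erasure to pending
  -- messages for channels.
  update-map : ∀ {f : ∀ x → C x} {g : ∀ x → B x} → (∀ x → f x ≡ h (g x)) →
               ∀ a {y z} → y ≡ h z →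
               ∀ x → update _≟_ f a y x ≡ h (update _≟_ g a z x)
  update-map f≡hg a y≡hz x with a ≟ x
  ... | yes refl = y≡hz
  ... | no  _    = f≡hg x

module _ (Sig : Signature) (S : Systems.System Sig) where

  open Systems Sig

  private
    module R = Reversible S
    module F = Standard (forgetSystem S)

  forget-transition : ∀ {A} (M : RCFSM A) {q e d q′ s} → s ≡ q →
    (q , e , d , q′) ∈ₗ transitions M →
    (s , e , q′) ∈ₗ CFSM.transitions (forgetMachine M)
  forget-transition _ refl = ∈-map⁺ _

  -- The source `f` is arbitrary up to `_≈_` because the matching step ends only pointwise equal to
  -- `forget S k′`, and the next step must start there.
  forget-step : ∀ {k k′ f} → k R.⟹ k′ → f F.≈ forget S k →
                ∃[ f′ ] (f F.⟶ f′ × f′ F.≈ forget S k′)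
  forget-step {f = F.⟨ τ , ψ ⟩} (R.out {χ = χ} c {m = m} t _) f≈k =
    _ , F.out c (forget-transition (S (sender c)) (state-≈ (sender c)) t) , record
      { state-≈   = update-map Fin._≟_ id state-≈ (sender c) refl
      ; buffers-≈ = update-map _≟ᶜ_ (λ x → map R.message (R.pending x)) buffers-≈ c
          (trans (cong (_++ [ m ]) (buffers-≈ c))
                 (sym (map-++ R.message (R.pending (χ c)) _)))
      }
    where open F._≈_ f≈k
  forget-step {f = F.⟨ τ , ψ ⟩} (R.inp c t eq refl) f≈k =
    _ , F.inp c (forget-transition (S (receiver c)) (state-≈ (receiver c)) t)
          (trans (buffers-≈ c) (cong (map R.message) eq)) , record
      { state-≈   = update-map Fin._≟_ id state-≈ (receiver c) refl
      -- The pending part after `consume` is by computation the tail of the old one.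
      ; buffers-≈ = update-map _≟ᶜ_ (λ x → map R.message (R.pending x)) buffers-≈ c refl
      }
    where open F._≈_ f≈k

  forget-run : ∀ {k k′ f} → Star R._⟹_ k k′ → f F.≈ forget S k →
               ∃[ f′ ] (Star F._⟶_ f f′ × f′ F.≈ forget S k′)
  forget-run ε        f≈k = _ , ε , f≈k
  forget-run (s ◅ ss) f≈k =
    let _ , s′  , f′≈k′ = forget-step s f≈k
        _ , ss′ , f″≈k″ = forget-run ss f′≈k′
    in  _ , s′ ◅ ss′ , f″≈k″

  forget-≈ : ∀ {k k′} → k R.≈ k′ → forget S k F.≈ forget S k′
  forget-≈ k≈k′ = record
    { state-≈   = state-≈
    ; buffers-≈ = λ c → cong (λ x → map R.message (R.pending x)) (buffers-≈ c)
    }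
    where open R._≈_ k≈k′

  ≈-trans : ∀ {f g h} → f F.≈ g → g F.≈ h → f F.≈ h
  ≈-trans p q = record
    { state-≈   = λ A → trans (F._≈_.state-≈ p A) (F._≈_.state-≈ q A)
    ; buffers-≈ = λ c → trans (F._≈_.buffers-≈ p c) (F._≈_.buffers-≈ q c)
    }

theorem1 : (Sig : Signature) → let open Systems Sig in
    (S : System) → (∀ A → Deterministic (S A)) →
    (k : Reversible.Config S) →
    k ∈ Reversible.RC S → forget S k ∈ Standard.RC (forgetSystem S)
theorem1 Sig S _ k (_ , run , k′≈k) =
  let _ , run′ , f≈k′ = forget-run Sig S run
                          (record { state-≈ = λ _ → refl ; buffers-≈ = λ _ → refl })
  -- The run ends in a configuration merely equal to `k` as a map; `forget` respects this equality.
  in  _ , run′ , ≈-trans Sig S f≈k′ (forget-≈ Sig S k′≈k)
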